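{- Every class of graphs with bounded $\mathrm{tree}\text{ - }\mu$ is $\chi$-bounded. That is, if $\mathcal{G}$ is a class of graphs for which there is an integer $\mu$ with $\mathrm{tree}\text{ - }\mu(G)\leq\mu$ for all $G\in\mathcal{G}$, then there is a function $f\colon\mathbb{N}\to\mathbb{N}$ such that every graph $G\in\mathcal{G}$ satisfies $\chi(G)\leq f(\omega(G))$.
   Context: All graphs are finite, simple, undirected, and have at least one vertex. $\mathbb{N}$ is the set of positive integers. $\chi(G)$ is the chromatic number of $G$ and $\omega(G)$ is the maximum size of a clique in $G$. A tree decomposition of a graph $G$ is a pair $\mathcal{T}=(T,\beta)$ where $T$ is a tree and $\beta$ maps each node $x$ of $T$ to a set $\beta(x)\subseteq V(G)$ (a bag) such that: (1) every vertex of $G$ belongs to some bag; (2) for every edge $uv$ of $G$, some bag contains both $u$ and $v$; (3) for every vertex $v$ of $G$, the set $\{x\in V(T)\mid v\in\beta(x)\}$ induces a connected subgraph of $T$. An induced matching in $G$ is a set $M$ of pairwise disjoint edges of $G$ such that no vertex of one edge of $M$ is adjacent in $G$ to a vertex of a different edge of $M$. An induced matching $M$ touches a set $X\subseteq V(G)$ if every edge of $M$ has at least one endpoint in $X$. For a tree decomposition $\mathcal{T}=(T,\beta)$ of $G$, $\mu(\mathcal{T})$ is the maximum, over $x\in V(T)$, of the maximum size of an induced matching in $G$ that touches $\beta(x)$. The induced matching treewidth $\mathrm{tree}\text{ - }\mu(G)$ is the minimum of $\mu(\mathcal{T})$ over all tree decompositions $\mathcal{T}$ of $G$. -}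

module Defs where

open import Data.Fin.Base using (Fin; zero; suc; inject₁; fromℕ; finToFun; funToFin)
open import Data.Fin.Properties using (any?; all?; injective⇒≤; finToFun-funToFin)
  renaming (_≟_ to _≟ᶠ_)
open import Data.Fin.Subset using (Subset; _∈_; ∣_∣) renaming (⊥ to ∅)
open import Data.Fin.Subset.Properties using (_∈?_; anySubset?; ∣p∣≤n; ∣⊥∣≡0; ∉⊥)
open import Data.List.Base using (map; allFin)
open import Data.List.Extrema.Nat using (max)
open import Data.Nat.Base using (ℕ; zero; suc; _+_; _^_; _≤_; z≤n; s≤s; NonZero)
open import Data.Nat.Properties using (m≤n⇒m<n∨m≡n; ≤-pred; _≟_)
open import Data.Product.Base using (∃; ∃-syntax; Σ-syntax; _×_; _,_; proj₁; proj₂)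
open import Data.Sum.Base using (inj₁; inj₂)
open import Function.Base using (_∘_; id)
open import Function.Definitions using (Injective)
open import Level using (Level; 0ℓ; _⊔_) renaming (suc to lsuc)
open import Relation.Binary.Construct.Closure.ReflexiveTransitive using (Star)
open import Relation.Binary.Core using (Rel)
open import Relation.Binary.Definitions using (Symmetric; Irreflexive) renaming (Decidable to Decidable₂)
open import Relation.Binary.PropositionalEquality
  using (_≡_; _≢_; _≗_; refl; sym; trans; cong; subst; subst₂)
open import Relation.Nullary using (¬_; Dec; yes; no; ¬?; contradiction)
open import Relation.Nullary.Decidable using (_×-dec_; _→-dec_; map′; decidable-stable)
open import Relation.Unary using (Pred; Decidable; U)

private
  variable
    ℓ : Level
    k m n : ℕ

IsLeast IsGreatest : Pred ℕ ℓ → Pred ℕ ℓ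
IsLeast    P m = P m × (∀ k → P k → m ≤ k)
IsGreatest P m = P m × (∀ k → P k → k ≤ m)

least : {P : Pred ℕ ℓ} → Decidable P → ∀ b → P b → ∃ (IsLeast P)
least P? zero    p = zero , p , λ _ _ → z≤n
least {P = P} P? (suc b) p with P? 0
... | yes p₀ = 0 , p₀ , λ _ _ → z≤n
... | no ¬p₀ with least (P? ∘ suc) b p
...   | m , pm , lo = suc m , pm , lo′
  where
  lo′ : ∀ k → P k → suc m ≤ k
  lo′ zero    q = contradiction q ¬p₀
  lo′ (suc k) q = s≤s (lo k q)

greatest : {P : Pred ℕ ℓ} → Decidable P → P 0 → ∀ b → (∀ k → P k → k ≤ b) → ∃ (IsGreatest P)
greatest P? p zero    hi = 0 , p , hi
greatest {P = P} P? p (suc b) hi with P? (suc b)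
... | yes q = suc b , q , hi
... | no ¬q = greatest P? p b hi′
  where
  hi′ : ∀ k → P k → k ≤ b
  hi′ k r with m≤n⇒m<n∨m≡n (hi k r)
  ... | inj₁ k<1+b = ≤-pred k<1+b
  ... | inj₂ refl  = contradiction r ¬q

anyFun? : {P : Pred (Fin m → Fin n) ℓ} → (∀ {f g} → f ≗ g → P f → P g) →
          Decidable P → Dec (∃ P)
anyFun? resp P? = map′
  (λ (i , p) → finToFun i , p)
  (λ (f , p) → funToFin f , resp (sym ∘ finToFun-funToFin f) p)
  (any? (P? ∘ finToFun))

-- Vertices are labelled by Fin order; graph classes below need not be closed under
-- isomorphism.
record Graph : Set₁ where
  infix 4 _~_ _~?_
  field
    order         : ℕ
    {{nonEmpty}}  : NonZero order

  Vertex : Set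
  Vertex = Fin order

  field
    _~_    : Rel Vertex 0ℓ
    _~?_   : Decidable₂ _~_
    ~-sym  : Symmetric _~_
    ~-irr  : Irreflexive _≡_ _~_

open Graph using (Vertex)

-- Every step of a walk stays inside S, so this is connectedness of the subgraph induced
-- by S.  It also holds for empty S, but the sets it is applied to are nonempty.
ConnectedOn : (G : Graph) → Pred (Vertex G) ℓ → Set ℓ
ConnectedOn G S = ∀ x y → S x → S y → Star (λ u v → S u × S v × u ~ v) x y
  where open Graph G using (_~_)

Connected : Graph → Set
Connected G = ConnectedOn G U

-- A cycle of length 3 + k.
IsCycle : (G : Graph) → (Fin (3 + k) → Vertex G) → Set
IsCycle {k} G c =
  Injective _≡_ _≡_ c
  × (∀ (i : Fin (2 + k)) → c (inject₁ i) ~ c (suc i))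
  × c (fromℕ (2 + k)) ~ c zero
  where open Graph G using (_~_)

IsTree : Graph → Set
IsTree T = Connected T × (∀ k (c : Fin (3 + k) → Vertex T) → ¬ IsCycle T c)

record TreeDecomposition (G : Graph) : Set₁ where
  open Graph G using (order; _~_)
  field
    tree           : Graph
    isTree         : IsTree tree
    bag            : Vertex tree → Subset order
    coversVertices : ∀ v → ∃[ x ] v ∈ bag x
    coversEdges    : ∀ u v → u ~ v → ∃[ x ] (u ∈ bag x × v ∈ bag x)
    connected      : ∀ v → ConnectedOn tree (λ x → v ∈ bag x)

module _ (G : Graph) where
  open Graph G using (order; _~_; _~?_; ~-irr)

  IsColouring : (Vertex G → Fin k) → Set
  IsColouring c = ∀ u v → u ~ v → c u ≢ c v

  Colourable : ℕ → Set
  Colourable k = ∃[ c ] IsColouring {k} c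

  IsClique : Subset order → Set
  IsClique S = ∀ u v → u ∈ S → v ∈ S → u ≢ v → u ~ v

  HasClique : ℕ → Set
  HasClique k = ∃[ S ] (IsClique S × ∣ S ∣ ≡ k)

  -- A set of k edges is enumerated by a family e, the i-th edge having the ends
  -- e i zero and e i (suc zero); disjointness makes the k edges distinct.
  Edges : ℕ → Set
  Edges k = Fin k → Fin 2 → Vertex G

  IsInducedMatching : Edges k → Set
  IsInducedMatching e =
    (∀ i → e i zero ~ e i (suc zero))
    × (∀ i j → i ≢ j → ∀ s t → e i s ≢ e j t × ¬ (e i s ~ e j t))

  Touches : Edges k → Subset order → Set
  Touches e X = ∀ i → ∃[ s ] e i s ∈ X

  HasTouchingMatching : Subset order → ℕ → Set
  HasTouchingMatching X k = ∃[ e ] (IsInducedMatching {k} e × Touches e X)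

  private
    colourable? : Decidable Colourable
    colourable? k = anyFun?
      (λ f≗g p u v a → p u v a ∘ λ eq → trans (f≗g u) (trans eq (sym (f≗g v))))
      (λ c → all? λ u → all? λ v → (u ~? v) →-dec ¬? (c u ≟ᶠ c v))

    hasClique? : Decidable HasClique
    hasClique? k = anySubset? λ S →
      (all? λ u → all? λ v → (u ∈? S) →-dec ((v ∈? S) →-dec (¬? (u ≟ᶠ v) →-dec (u ~? v))))
      ×-dec (∣ S ∣ ≟ k)

    decode : (Fin k → Fin (order ^ 2)) → Edges k
    decode f i = finToFun (f i)

    Good : Subset order → Edges k → Set
    Good X e = IsInducedMatching e × Touches e X

    good-resp : ∀ X {e e′ : Edges k} → (∀ i s → e i s ≡ e′ i s) → Good X e → Good X e′
    good-resp X eq ((p , q) , t) =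
      ( (λ i → subst₂ _~_ (eq i zero) (eq i (suc zero)) (p i))
      , (λ i j i≢j s t → subst₂ (λ a b → a ≢ b × ¬ (a ~ b)) (eq i s) (eq j t) (q i j i≢j s t)))
      , (λ i → proj₁ (t i) , subst (_∈ X) (eq i (proj₁ (t i))) (proj₂ (t i)))

    good? : ∀ X → Decidable (Good {k} X)
    good? X e =
      ((all? λ i → e i zero ~? e i (suc zero))
       ×-dec (all? λ i → all? λ j → ¬? (i ≟ᶠ j) →-dec (all? λ s → all? λ t →
               ¬? (e i s ≟ᶠ e j t) ×-dec ¬? (e i s ~? e j t))))
      ×-dec (all? λ i → any? λ s → e i s ∈? X)

    hasTouchingMatching? : ∀ X → Decidable (HasTouchingMatching X)
    hasTouchingMatching? X k = map′
      (λ (f , p) → decode f , p)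
      (λ (e , p) → (funToFin ∘ e) , good-resp X (λ i s → sym (finToFun-funToFin (e i) s)) p)
      (anyFun? {P = Good X ∘ decode}
        (λ f≗g → good-resp X (λ i s → cong (λ z → finToFun z s) (f≗g i)))
        (good? X ∘ decode))

    matching≤order : ∀ X k → HasTouchingMatching X k → k ≤ order
    matching≤order X k (e , (_ , q) , _) = injective⇒≤ {f = λ i → e i zero} λ {i} {j} eq →
      decidable-stable (i ≟ᶠ j) λ i≢j → proj₁ (q i j i≢j zero zero) eq

  chromaticNumber : ∃ (IsLeast Colourable)
  chromaticNumber = least colourable? order
    (id , λ { u _ u~u refl → ~-irr refl u~u })

  cliqueNumber : ∃ (IsGreatest HasClique)
  cliqueNumber = greatest hasClique?
    (∅ , (λ _ _ u∈∅ → contradiction u∈∅ ∉⊥) , ∣⊥∣≡0 order)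
    order (λ { _ (S , _ , refl) → ∣p∣≤n S })

  touchingNumber : ∀ X → ∃ (IsGreatest (HasTouchingMatching X))
  touchingNumber X = greatest (hasTouchingMatching? X)
    ((λ ()) , ((λ ()) , (λ ())) , (λ ()))
    order (matching≤order X)

  χ ω : ℕ
  χ = proj₁ chromaticNumber
  ω = proj₁ cliqueNumber

  maxTouching : Subset order → ℕ
  maxTouching X = proj₁ (touchingNumber X)

μ : {G : Graph} → TreeDecomposition G → ℕ
μ {G} 𝒯 = max 0 (map (maxTouching G ∘ bag) (allFin (Graph.order tree)))
  where open TreeDecomposition 𝒯

-- A relation, not a function like χ and ω: the minimum ranges over decompositions with
-- arbitrarily many nodes, so it is not found by a finite search.
IsTree-μ : Graph → ℕ → Set₁
IsTree-μ G = IsLeast (λ k → Σ[ 𝒯 ∈ TreeDecomposition G ] μ 𝒯 ≡ k)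

GraphClass : ∀ ℓ → Set (lsuc 0ℓ ⊔ lsuc ℓ)
GraphClass ℓ = Pred Graph ℓ

BoundedTree-μ : GraphClass ℓ → Set (lsuc 0ℓ ⊔ ℓ)
BoundedTree-μ 𝒢 = Σ[ b ∈ ℕ ] ∀ G → 𝒢 G → ∃[ m ] (IsTree-μ G m × m ≤ b)

χ-Bounded : GraphClass ℓ → Set (lsuc 0ℓ ⊔ ℓ)
χ-Bounded 𝒢 = Σ[ f ∈ (ℕ → ℕ) ] ∀ G → 𝒢 G → χ G ≤ f (ω G)

{-# OPTIONS --safe #-}
-- Induct on the clique number ω and the matching bound μ, so that neighbourhoods N(v) have
-- bounded χ.  Grow a connected set D with at least one edge by adding W = N(D) repeatedly; the
-- next layer L ⊆ N(W) is anticomplete to D, and it suffices to colour each layer, alternating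
-- two palettes.  Let M be the subtree of nodes whose bags meet D.  On the vertices of L whose
-- bags reach M the decomposition restricts to M, and every bag of M touches an edge of D,
-- anticomplete to L, so μ drops by one.  The other vertices of L split into pairwise
-- anticomplete classes, one for each gate y in M through which paths enter M.  The class of y
-- is dominated by W ∩ bag y.  Members of a minimal dominating subset have private neighbours,
-- and as ω and μ are bounded, a Ramsey-type recursion covers the class by boundedly many N(v).
module Submission where

open import Defs
open import Data.Bool.Base using (Bool; true; false; not)
open import Data.Bool.Properties using (not-injective)
open import Data.Empty using (⊥)
open import Data.Fin.Base using (Fin; zero; suc; inject₁; fromℕ; inject≤; join; splitAt; combine)
open import Data.Fin.Properties
  using (any?; all?; ¬∀⟶∃¬; suc-injective; inject≤-injective; splitAt-join; combine-injective)
  renaming (_≟_ to _≟ᶠ_)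
open import Data.Fin.Subset using (Subset; _∈_; _∉_; _⊂_; _-_; ∣_∣; inside; outside)
  renaming (_⊆_ to _⊆ˢ_; ⊥ to ∅)
open import Data.Fin.Subset.Induction using (⊂-wellFounded; Acc; acc)
open import Data.Fin.Subset.Properties
  using (_∈?_; x∈p∧x≢y⇒x∈p-y; x∈p⇒p-x⊂p; p─q⊆p; ∉⊥; ∣⊥∣≡0)
open import Data.List.Base using (map; allFin)
open import Data.List.Extrema.Nat using (xs≤max)
open import Data.List.Membership.Propositional.Properties using (∈-map⁺; ∈-allFin)
open import Data.List.Relation.Unary.All using (lookup)
open import Data.Nat.Base using (ℕ; zero; suc; _+_; _*_; _≤_)
open import Data.Nat.Properties using (n≤1+n; m≤m+n; m≤n+m; ≤-trans; +-identityʳ; +-suc; 1+n≰n)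
open import Data.Product.Base using (∃; ∃-syntax; Σ-syntax; _×_; _,_; proj₁; proj₂; map₂)
open import Data.Sum.Base using (_⊎_; inj₁; inj₂; [_,_]′)
open import Data.Sum.Properties using (inj₁-injective; inj₂-injective)
open import Data.Unit.Base using (tt)
open import Data.Vec.Base using (_∷_; _[_]≔_; here; there; tabulate)
open import Data.Vec.Properties using (lookup⇒[]=; []=⇒lookup; lookup∘tabulate; lookup∘update′)
open import Function.Base using (_∘_; id; _∘′_)
open import Function.Definitions using (Injective)
open import Level using (0ℓ)
open import Relation.Binary.Construct.Closure.ReflexiveTransitive
  using (Star; ε; _◅_; _◅◅_; reverse) renaming (map to mapStar)
open import Relation.Binary.Core using (Rel)
open import Relation.Binary.PropositionalEquality
  using (_≡_; _≢_; refl; sym; trans; cong; subst)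
open import Relation.Nullary using (¬_; yes; no; does; ¬?; contradiction)
open import Relation.Nullary.Decidable using (_×-dec_; _⊎-dec_; _→-dec_; dec-true; decidable-stable)
open import Relation.Unary using (Pred; Decidable; _⊆_; _∪_; U)

private variable
  j k m n : ℕ

-- Simple paths extracted from walks.

record SimplePath (R : Rel (Fin n) 0ℓ) (x y : Fin n) : Set where
  constructor simplePath
  field
    {length}  : ℕ
    path      : Fin (suc length) → Fin n
    injective : Injective _≡_ _≡_ path
    starts    : path zero ≡ x
    ends      : path (fromℕ length) ≡ y
    steps     : ∀ i → R (path (inject₁ i)) (path (suc i))

suffix : ∀ {R : Rel (Fin n) 0ℓ} {x y} (p : SimplePath R x y) i →
         SimplePath R (SimplePath.path p i) y
suffix (simplePath p inj _ e s) zero = simplePath p inj refl e s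
suffix (simplePath {suc _} p inj _ e s) (suc i) =
  suffix (simplePath (p ∘ suc) (suc-injective ∘′ inj) refl e (s ∘ suc)) i

simplify : ∀ {R : Rel (Fin n) 0ℓ} {x y} → Star R x y → SimplePath R x y
simplify {x = x} ε = simplePath {length = 0} (λ _ → x) (λ { {zero} {zero} _ → refl })
  refl refl λ ()
simplify {n} {R} {x} (r ◅ w) with simplify w
... | P@(simplePath {l} p inj st e s) with any? (λ i → p i ≟ᶠ x)
...   | yes (i , refl) = suffix P i
...   | no x∉p = simplePath q q-inj refl e q-steps
  where
  q : Fin (suc (suc l)) → Fin n
  q zero    = x
  q (suc i) = p i
  q-inj : Injective _≡_ _≡_ q
  q-inj {zero}  {zero}  _  = refl
  q-inj {zero}  {suc j} eq = contradiction (j , sym eq) x∉p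
  q-inj {suc i} {zero}  eq = contradiction (i , eq) x∉p
  q-inj {suc i} {suc j} eq = cong suc (inj eq)
  q-steps : ∀ i → R (q (inject₁ i)) (q (suc i))
  q-steps zero    = subst (R x) (sym st) r
  q-steps (suc i) = s i

-- Gates of a connected set of nodes in a tree.

module _ (T : Graph) (isTree : IsTree T) where
  open Graph T using (Vertex; _~_; ~-sym; ~-irr)

  -- A simple path between the ends that avoids this step has at least two edges, so the edge closes
  -- it to a cycle.
  bridge : ∀ {x y} → x ~ y → ¬ Star (λ u v → u ~ v × ¬ (u ≡ x × v ≡ y)) x y
  bridge x~y w with simplify w
  ... | simplePath {zero} p _ refl refl _ = ~-irr refl x~y
  ... | simplePath {suc zero} p _ st e s = proj₂ (s zero) (st , e)
  ... | simplePath {suc (suc k)} p inj refl refl s =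
    proj₂ isTree k p (inj , proj₁ ∘ s , ~-sym x~y)

  module _ {M : Pred Vertex 0ℓ} (M? : Decidable M) where

    -- Every step starts outside `M`, so the walk stops at its first node in `M`. For connected `M`
    -- in a tree, `z` is the projection of `t` to `M`.
    Gate : Rel Vertex 0ℓ
    Gate t z = Star (λ u v → ¬ M u × u ~ v) t z × M z

    gate-self : ∀ {t z} → M t → Gate t z → t ≡ z
    gate-self Mt (ε , _)            = refl
    gate-self Mt ((¬Mt , _) ◅ _ , _) = contradiction Mt ¬Mt

    gate-back : ∀ {t u z} → ¬ M u → t ~ u → Gate t z → Gate u z
    gate-back ¬Mu t~u (w , Mz) = (¬Mu , ~-sym t~u) ◅ w , Mz

    -- Cut the walk at its first node in `M`. Keeping `S` at the gate is what later puts a vertex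
    -- into the bag of the gate.
    first-hit : ∀ {S : Pred Vertex 0ℓ} {t y} → S t → M y →
                Star (λ u v → S u × S v × u ~ v) t y → ∃[ z ] (Gate t z × S z)
    first-hit {t = t} St My w with M? t
    ... | yes Mt = t , (ε , Mt) , St
    first-hit St My ε | no ¬Mt = contradiction My ¬Mt
    first-hit St My ((_ , Su , t~u) ◅ w) | no ¬Mt
      with z , (g , Mz) , Sz ← first-hit Su My w = z , ((¬Mt , t~u) ◅ g , Mz) , Sz

    module _ (conn : ConnectedOn T M) where

      gate-unique : ∀ {t y z} → Gate t y → Gate t z → y ≡ z
      gate-unique {y = y} {z} (w₀ , My) = go w₀
        where
        go : ∀ {t} → Star (λ u v → ¬ M u × u ~ v) t y → Gate t z → y ≡ z
        go ε g = gate-self My g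
        go {t} ((¬Mt , t~u) ◅ w) g with M? _
        ... | no ¬Mu = go w (gate-back ¬Mu t~u g)
        ... | yes Mu with refl ← gate-self Mu (w , My) with y ≟ᶠ z
        ...   | yes y≡z = y≡z
        -- Here `u` is `y`. The second walk from `t` to `z`, continued inside `M` to `y`, avoids the
        -- step from `t` to `y`: a walk that enters `y` stops there, and `M` does not contain `t`.
        ...   | no  y≢z = contradiction (to-M g ◅◅ within-M) (bridge t~u)
          where
          to-M : ∀ {v} → Gate v z → Star (λ u v → u ~ v × ¬ (u ≡ t × v ≡ y)) v z
          to-M (ε , _) = ε
          to-M ((_ , u~v) ◅ w , Mz) =
            (u~v , λ { (_ , refl) → y≢z (gate-self My (w , Mz)) }) ◅ to-M (w , Mz)
          within-M : Star (λ u v → u ~ v × ¬ (u ≡ t × v ≡ y)) z y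
          within-M = mapStar (λ (Mu , _ , u~v) → u~v , λ { (refl , _) → ¬Mt Mu })
                           (conn z y (proj₂ g) My)

      -- The gate of the current node traces a walk in `M`. Outside `M` the gate stands still, and
      -- by uniqueness the walk re-enters where it left, so the projection also stays in `S`.
      ∩-connected : {S : Pred Vertex 0ℓ} → ConnectedOn T S → ConnectedOn T (λ x → M x × S x)
      ∩-connected {S} connS x y (Mx , Sx) (My , Sy) = project (ε , Mx) Sx (connS x y Sx Sy)
        where
        project : ∀ {t z} → Gate t z → S z → Star (λ u v → S u × S v × u ~ v) t y →
                  Star (λ u v → (M u × S u) × (M v × S v) × u ~ v) z y
        project g Sz ε with refl ← gate-self My g = ε
        project {t} {z} g@(_ , Mz) Sz (_◅_ {j = u} (St , Su , t~u) w) with M? t | M? u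
        ... | yes Mt | yes Mu with refl ← gate-self Mt g =
          ((Mt , St) , (Mu , Su) , t~u) ◅ project (ε , Mu) Su w
        ... | yes Mt | no ¬Mu = project (gate-back ¬Mu t~u g) Sz w
        ... | no ¬Mt | no ¬Mu = project (gate-back ¬Mu t~u g) Sz w
        ... | no ¬Mt | yes Mu with refl ← gate-unique g ((¬Mt , t~u) ◅ ε , Mu) =
          project (ε , Mu) Su w

-- Decidable predicates as subsets, and choice functions.

⟪_⟫ : {P : Pred (Fin n) 0ℓ} → Decidable P → Subset n
⟪ P? ⟫ = tabulate (does ∘ P?)

module _ {P : Pred (Fin n) 0ℓ} (P? : Decidable P) where

  ∈⟪⟫⁺ : ∀ {i} → P i → i ∈ ⟪ P? ⟫
  ∈⟪⟫⁺ {i} p = lookup⇒[]= i _ (trans (lookup∘tabulate (does ∘ P?) i) (dec-true (P? i) p))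

  ∈⟪⟫⁻ : ∀ {i} → i ∈ ⟪ P? ⟫ → P i
  ∈⟪⟫⁻ {i} i∈ with P? i | trans (sym (lookup∘tabulate (does ∘ P?) i)) ([]=⇒lookup i∈)
  ... | yes p | _ = p

  choose : {R : Fin n → Fin m → Set} → (Fin n → Fin m) →
           (∀ i → P i → ∃ (R i)) →
           ∃[ f ] ∀ i → P i → R i (f i)
  choose {R = R} default r = f , f-R
    where
    f : Fin _ → Fin _
    f i with P? i
    ... | yes p = proj₁ (r i p)
    ... | no _  = default i
    f-R : ∀ i → P i → R i (f i)
    f-R i p with P? i
    ... | yes q = proj₂ (r i q)
    ... | no ¬p = contradiction p ¬p

-- Colourings of vertex sets with bounded cliques and matchings.

dominatedColours : ℕ → ℕ → ℕ → ℕ → ℕ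
dominatedColours c zero    a       b       = 1
dominatedColours c (suc m) zero    b       = 1
dominatedColours c (suc m) (suc a) zero    = 1
-- A Ramsey-type recurrence: `c` colours for the neighbourhood of one index, then branches that
-- lower the matching bound `m`, the clique bound `a` on the indices, or the clique bound `b` on
-- their private neighbours. The extra `suc` leaves a colour when there is no index.
dominatedColours c (suc m) (suc a) (suc b) = suc (c +
  (dominatedColours c m (suc a) (suc b) +
  (dominatedColours c (suc m) a (suc b) + dominatedColours c (suc m) (suc a) b)))

module _ (G : Graph) where
  open Graph G using (Vertex; order; _~_; _~?_; ~-sym; ~-irr)

  private variable
    P Q : Pred Vertex 0ℓ

  ColourableOn : Pred Vertex 0ℓ → ℕ → Set
  ColourableOn P k = Σ[ c ∈ (Vertex → Fin k) ] ∀ u v → P u → P v → u ~ v → c u ≢ c v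

  colourable-⊆ : P ⊆ Q → ColourableOn Q k → ColourableOn P k
  colourable-⊆ P⊆Q (c , proper) = c , λ u v Pu Pv → proper u v (P⊆Q Pu) (P⊆Q Pv)

  colourable-≤ : j ≤ k → ColourableOn P j → ColourableOn P k
  colourable-≤ j≤k (c , proper) =
    (λ v → inject≤ (c v) j≤k) , λ u v Pu Pv u~v → proper u v Pu Pv u~v ∘ inject≤-injective _ _ _ _

  colourable-edgeless : (∀ u v → P u → P v → ¬ (u ~ v)) → ColourableOn P (suc k)
  colourable-edgeless none = (λ _ → zero) , λ u v Pu Pv u~v _ → none u v Pu Pv u~v

  colourable-∪ : Decidable P → ColourableOn P j → ColourableOn Q k → ColourableOn (P ∪ Q) (j + k)
  colourable-∪ {P} {j} {Q} {k} P? (c , c-proper) (d , d-proper) =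
    join j k ∘ e , λ u v Pu Pv u~v eq → e-proper u v Pu Pv u~v (join-injective eq)
    where
    join-injective : ∀ {x y} → join j k x ≡ join j k y → x ≡ y
    join-injective {x} {y} eq =
      trans (sym (splitAt-join j k x)) (trans (cong (splitAt j) eq) (splitAt-join j k y))
    e : Vertex → Fin j ⊎ Fin k
    e v with P? v
    ... | yes _ = inj₁ (c v)
    ... | no  _ = inj₂ (d v)
    in-Q : ∀ {v} → ¬ P v → (P ∪ Q) v → Q v
    in-Q ¬Pv (inj₁ Pv) = contradiction Pv ¬Pv
    in-Q _   (inj₂ Qv) = Qv
    e-proper : ∀ u v → (P ∪ Q) u → (P ∪ Q) v → u ~ v → e u ≢ e v
    e-proper u v PQu PQv u~v eq with P? u | P? v
    ... | yes Pu | yes Pv = c-proper u v Pu Pv u~v (inj₁-injective eq)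
    ... | no ¬Pu | no ¬Pv = d-proper u v (in-Q ¬Pu PQu) (in-Q ¬Pv PQv) u~v (inj₂-injective eq)

  Nbr : Pred Vertex 0ℓ → Pred Vertex 0ℓ
  Nbr P v = ∃[ u ] (P u × u ~ v)

  Nbr? : Decidable P → Decidable (Nbr P)
  Nbr? P? v = any? λ u → P? u ×-dec (u ~? v)

  -- `P` has no clique on more than `k` vertices, phrased by descent into neighbourhoods to match
  -- the recursions on it.
  CliqueBound : ℕ → Pred Vertex 0ℓ → Set
  CliqueBound zero    P = ∀ v → ¬ P v
  CliqueBound (suc k) P = ∀ v → P v → CliqueBound k (λ u → P u × v ~ u)

  cliqueBound-⊆ : ∀ k → P ⊆ Q → CliqueBound k Q → CliqueBound k P
  cliqueBound-⊆ zero    P⊆Q cb v Pv = cb v (P⊆Q Pv)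
  cliqueBound-⊆ (suc k) P⊆Q cb v Pv =
    cliqueBound-⊆ k (λ (Pu , v~u) → P⊆Q Pu , v~u) (cb v (P⊆Q Pv))

  -- Induced matchings are peeled off edge by edge: excluding the neighbours of u and v also
  -- excludes u and v themselves.
  MatchingBound : ℕ → Pred Vertex 0ℓ → Pred Vertex 0ℓ → Set
  MatchingBound zero    X P = ∀ u v → P u → P v → X u → ¬ (u ~ v)
  MatchingBound (suc m) X P = ∀ u v → P u → P v → X u → u ~ v →
    MatchingBound m X (λ w → P w × ¬ (u ~ w) × ¬ (v ~ w))

  matchingBound-⊆ : ∀ m {X} → P ⊆ Q → MatchingBound m X Q → MatchingBound m X P
  matchingBound-⊆ zero    P⊆Q mb u v Pu Pv = mb u v (P⊆Q Pu) (P⊆Q Pv)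
  matchingBound-⊆ (suc m) P⊆Q mb u v Pu Pv Xu u~v =
    matchingBound-⊆ m (λ (Pw , far) → P⊆Q Pw , far) (mb u v (P⊆Q Pu) (P⊆Q Pv) Xu u~v)

  -- Private neighbours and dominated sets.

  minimal-dominating : ∀ {C : Pred Vertex 0ℓ} → Decidable C → (W : Subset order) → C ⊆ Nbr (_∈ W) →
    ∃[ I ] (I ⊆ˢ W × C ⊆ Nbr (_∈ I)
           × (∀ w → w ∈ I → ∃[ v ] (C v × w ~ v × (∀ u → u ∈ I → u ~ v → u ≡ w))))
  minimal-dominating {C} C? W = go W (⊂-wellFounded W)
    where
    go : ∀ W → Acc _⊂_ W → C ⊆ Nbr (_∈ W) → ∃[ I ] (I ⊆ˢ W × C ⊆ Nbr (_∈ I)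
           × (∀ w → w ∈ I → ∃[ v ] (C v × w ~ v × (∀ u → u ∈ I → u ~ v → u ≡ w))))
    go W (acc rec) dom
      with any? (λ w → (w ∈? W) ×-dec (all? λ v → C? v →-dec Nbr? (_∈? (W - w)) v))
    ... | yes (w , w∈W , dom′)
      with I , I⊆ , rest ← go (W - w) (rec (x∈p⇒p-x⊂p w∈W)) (dom′ _) =
      I , (λ i∈ → p─q⊆p W _ (I⊆ i∈)) , rest
    -- Without `w` some `v` of `C` is undominated. Since `W` dominates `v`, this `v` is private to
    -- `w`.
    ... | no irredundant = W , id , dom , λ w w∈W → priv w w∈W
      (¬∀⟶∃¬ order _ (λ v → C? v →-dec Nbr? (_∈? (W - w)) v)
        (λ dom′ → irredundant (w , w∈W , dom′)))
      where
      priv : ∀ w → w ∈ W → (∃[ v ] ¬ (C v → Nbr (_∈ (W - w)) v)) →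
             ∃[ v ] (C v × w ~ v × (∀ u → u ∈ W → u ~ v → u ≡ w))
      priv w w∈W (v , ¬dom) = v , Cv , w~v , only
        where
        Cv : C v
        Cv = decidable-stable (C? v) λ ¬Cv → ¬dom λ Cv → contradiction Cv ¬Cv
        only : ∀ u → u ∈ W → u ~ v → u ≡ w
        only u u∈W u~v = decidable-stable (u ≟ᶠ w) λ u≢w →
          ¬dom λ _ → u , x∈p∧x≢y⇒x∈p-y u∈W u≢w , u~v
        w~v : w ~ v
        w~v with u , u∈W , u~v ← dom Cv = subst (_~ v) (only u u∈W u~v) u~v

  module _ {A X : Pred Vertex 0ℓ} (A? : Decidable A) {c : ℕ}
           (nbhd : ∀ v → A v → ColourableOn (λ u → A u × v ~ u) c) where

    module _ (p : Vertex → Vertex) where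

      private
        none : ∀ {I : Pred Vertex 0ℓ} → (∀ w → ¬ I w) → ColourableOn (λ v → A v × Nbr I v) (suc k)
        none ¬I = colourable-edgeless λ { _ _ (_ , w , Iw , _) _ _ → ¬I w Iw }

      -- The indices w ∈ I split, relative to one of them, into the adjacent ones, those with
      -- adjacent private neighbours, and those whose edge w—p w extends the matching.
      private-pairs-colourable : ∀ m a b {I B : Pred Vertex 0ℓ} → Decidable I →
        (∀ w → I w → A w × X w × B w × B (p w) × w ~ p w) →
        (∀ w u → I w → I u → u ~ p w → u ≡ w) →
        CliqueBound a I → CliqueBound b (λ v → ∃[ w ] (I w × p w ≡ v)) → MatchingBound m X B →
        ColourableOn (λ v → A v × Nbr I v) (dominatedColours c m a b)
      private-pairs-colourable zero a b I? pair only cbI cbp mb = none λ w Iw →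
        let _ , Xw , Bw , Bp , w~p = pair w Iw in mb w (p w) Bw Bp Xw w~p
      private-pairs-colourable (suc m) zero b I? pair only cbI cbp mb = none cbI
      private-pairs-colourable (suc m) (suc a) zero I? pair only cbI cbp mb =
        none λ w Iw → cbp (p w) (w , Iw , refl)
      private-pairs-colourable (suc m) (suc a) (suc b) {I} {B} I? pair only cbI cbp mb
        with any? I?
      ... | no ¬I = none λ w Iw → ¬I (w , Iw)
      ... | yes (w₀ , Iw₀) = colourable-≤ (n≤1+n _) (colourable-⊆ split
        (colourable-∪ (λ v → A? v ×-dec (w₀ ~? v)) (nbhd w₀ (proj₁ (pair w₀ Iw₀)))
        (colourable-∪ (λ v → A? v ×-dec Nbr? I₁? v)
          (private-pairs-colourable m (suc a) (suc b) I₁? pair₁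
            (λ w u (Iw , _) (Iu , _) → only w u Iw Iu)
            (cliqueBound-⊆ (suc a) proj₁ cbI)
            (cliqueBound-⊆ (suc b) (λ (w , (Iw , _) , eq) → w , Iw , eq) cbp)
            (mb w₀ (p w₀) Bw₀ Bp₀ Xw₀ w₀~p₀))
        (colourable-∪ (λ v → A? v ×-dec Nbr? I₂? v)
          (private-pairs-colourable (suc m) a (suc b) I₂? (λ w (Iw , _) → pair w Iw)
            (λ w u (Iw , _) (Iu , _) → only w u Iw Iu)
            -- `I₂` lies in the neighbourhood of `w₀`, so its clique bound drops by one.
            (cbI w₀ Iw₀)
            (cliqueBound-⊆ (suc b) (λ (w , (Iw , _) , eq) → w , Iw , eq) cbp)
            mb)
          (private-pairs-colourable (suc m) (suc a) b I₃? (λ w (Iw , _) → pair w Iw)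
            (λ w u (Iw , _) (Iu , _) → only w u Iw Iu)
            (cliqueBound-⊆ (suc a) proj₁ cbI)
            -- For `I₃` it is the private neighbours that lie in one neighbourhood, that of `p w₀`.
            (cliqueBound-⊆ b (λ { (w , (Iw , p₀~p) , refl) → (w , Iw , refl) , p₀~p })
              (cbp (p w₀) (w₀ , Iw₀ , refl)))
            mb)))))
        where
        Xw₀ = proj₁ (proj₂ (pair w₀ Iw₀))
        Bw₀ = proj₁ (proj₂ (proj₂ (pair w₀ Iw₀)))
        Bp₀ = proj₁ (proj₂ (proj₂ (proj₂ (pair w₀ Iw₀))))
        w₀~p₀ = proj₂ (proj₂ (proj₂ (proj₂ (pair w₀ Iw₀))))
        I₁ I₂ I₃ : Pred Vertex 0ℓ
        -- Neither adjacency condition removes `w₀` itself, as there are no loops.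
        I₁ w = I w × ¬ (w₀ ~ w) × ¬ (p w₀ ~ p w) × w ≢ w₀
        I₂ w = I w × w₀ ~ w
        I₃ w = I w × p w₀ ~ p w
        I₁? : Decidable I₁
        I₁? w = I? w ×-dec ¬? (w₀ ~? w) ×-dec ¬? (p w₀ ~? p w) ×-dec ¬? (w ≟ᶠ w₀)
        I₂? : Decidable I₂
        I₂? w = I? w ×-dec (w₀ ~? w)
        I₃? : Decidable I₃
        I₃? w = I? w ×-dec (p w₀ ~? p w)
        -- Peeling off an edge shrinks only the region `B` of later matching edges; the set `A`
        -- being coloured stays fixed.
        B₁ : Pred Vertex 0ℓ
        B₁ v = B v × ¬ (w₀ ~ v) × ¬ (p w₀ ~ v)
        pair₁ : ∀ w → I₁ w → A w × X w × B₁ w × B₁ (p w) × w ~ p w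
        -- Adjacency of `w` to `p w₀`, or of `w₀` to `p w`, would contradict privacy; `I₁` rules out
        -- the other two.
        pair₁ w (Iw , w₀≁w , p₀≁p , w≢w₀) with Aw , Xw , Bw , Bp , w~p ← pair w Iw =
          Aw , Xw ,
          (Bw , w₀≁w , λ p₀~w → w≢w₀ (only w₀ w Iw₀ Iw (~-sym p₀~w))) ,
          (Bp , (λ w₀~p → w≢w₀ (sym (only w w₀ Iw Iw₀ w₀~p))) , p₀≁p) , w~p
        split : ∀ {v} → A v × Nbr I v →
          (A v × w₀ ~ v) ⊎ (A v × Nbr I₁ v) ⊎ (A v × Nbr I₂ v) ⊎ (A v × Nbr I₃ v)
        split (Av , w , Iw , w~v) with w ≟ᶠ w₀ | w₀ ~? w | p w₀ ~? p w
        ... | yes refl | _ | _ = inj₁ (Av , w~v)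
        ... | no _ | yes w₀~w | _ = inj₂ (inj₂ (inj₁ (Av , w , (Iw , w₀~w) , w~v)))
        ... | no _ | no _ | yes p₀~p = inj₂ (inj₂ (inj₂ (Av , w , (Iw , p₀~p) , w~v)))
        ... | no w≢w₀ | no w₀≁w | no p₀≁p =
          inj₂ (inj₁ (Av , w , (Iw , w₀≁w , p₀≁p , w≢w₀) , w~v))

    -- A minimal subset of `W` that still dominates the same part of `A` provides private
    -- neighbours. These and the indices lie in `A`, so both clique bounds start at `k`.
    dominated-colourable : ∀ k m {W} → Decidable W → (∀ w → W w → A w × X w) →
      CliqueBound k A → MatchingBound m X A →
      ColourableOn (λ v → A v × Nbr W v) (dominatedColours c m k k)
    dominated-colourable k m {W} W? W⊆ cb mb
      with I , I⊆W , dom , priv ← minimal-dominating (λ v → A? v ×-dec Nbr? W? v) ⟪ W? ⟫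
             (λ (_ , w , Ww , w~v) → w , ∈⟪⟫⁺ W? Ww , w~v)
      with p , p-priv ← choose (_∈? I) id priv =
      colourable-⊆ (λ (Av , Wv) → Av , dom (Av , Wv)) (private-pairs-colourable p m k k (_∈? I)
        (λ w w∈I → let (Ap , _) , w~p , _ = p-priv w w∈I
                       Aw , Xw = W⊆ w (∈⟪⟫⁻ W? (I⊆W w∈I))
                   in Aw , Xw , Aw , Ap , w~p)
        (λ w u w∈I u∈I → proj₂ (proj₂ (p-priv w w∈I)) u u∈I)
        (cliqueBound-⊆ k (λ w∈I → proj₁ (W⊆ _ (∈⟪⟫⁻ W? (I⊆W w∈I)))) cb)
        (cliqueBound-⊆ k (λ { (w , w∈I , refl) → proj₁ (proj₁ (p-priv w w∈I)) }) cb)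
        mb)

  -- Layers around a growing connected core.

  Core : Pred Vertex 0ℓ → Set
  Core D = ConnectedOn G D × D ⊆ Nbr D

  -- Seeds a core. The neighbour of each core vertex inside the core later yields an edge,
  -- anticomplete to the layer, that lowers the matching bound.
  core-edge : ∀ {s t} → s ~ t → Core (λ v → v ≡ s ⊎ v ≡ t)
  core-edge s~t =
    (λ { _ _ (inj₁ refl) (inj₁ refl) → ε
       ; _ _ (inj₁ refl) (inj₂ refl) → (inj₁ refl , inj₂ refl , s~t) ◅ ε
       ; _ _ (inj₂ refl) (inj₁ refl) → (inj₂ refl , inj₁ refl , ~-sym s~t) ◅ ε
       ; _ _ (inj₂ refl) (inj₂ refl) → ε }) ,
    λ { (inj₁ refl) → _ , inj₂ refl , ~-sym s~t ; (inj₂ refl) → _ , inj₁ refl , s~t }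

  core-extend : ∀ {D W} → Core D → W ⊆ Nbr D → Core (D ∪ W)
  core-extend {D} {W} (conn , nbr) W⊆ = conn′ , nbr′
    where
    Step = λ u v → (D ∪ W) u × (D ∪ W) v × u ~ v
    to-D : ∀ {v} → (D ∪ W) v → ∃[ d ] (D d × Star Step v d)
    to-D {v} (inj₁ Dv) = v , Dv , ε
    to-D (inj₂ Wv) with d , Dd , d~v ← W⊆ Wv =
      d , Dd , (inj₂ Wv , inj₁ Dd , ~-sym d~v) ◅ ε
    conn′ : ConnectedOn G (D ∪ W)
    conn′ x y DWx DWy with d , Dd , x⟶d ← to-D DWx | e , De , y⟶e ← to-D DWy =
      x⟶d ◅◅ mapStar (λ (Du , Dv , u~v) → inj₁ Du , inj₁ Dv , u~v) (conn d e Dd De)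
          ◅◅ reverse (λ (Du , Dv , u~v) → Dv , Du , ~-sym u~v) y⟶e
    nbr′ : D ∪ W ⊆ Nbr (D ∪ W)
    nbr′ (inj₁ Dv) with d , Dd , d~v ← nbr Dv = d , inj₁ Dd , d~v
    nbr′ (inj₂ Wv) with d , Dd , d~v ← W⊆ Wv = d , inj₁ Dd , d~v

  -- Consecutive layers around D get opposite sides, so only the colourings of single
  -- layers have to be proper.
  record LayerColouring (D : Pred Vertex 0ℓ) (Q : Subset order) (k : ℕ) : Set where
    field
      side      : Vertex → Bool
      colour    : Vertex → Fin k
      proper    : ∀ u v → u ∈ Q → v ∈ Q → u ~ v → side u ≡ side v → colour u ≢ colour v
      firstSide : ∀ v → v ∈ Q → Nbr D v → side v ≡ false

  module _ {A : Pred Vertex 0ℓ} {k : ℕ}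
    (starts : ∀ s t → A s → A t → ColourableOn (λ v → A v × (s ~ v ⊎ t ~ v)) (2 + k))
    (layer : ∀ {D W L} → Decidable D → Decidable W → Decidable L → D ⊆ A → W ⊆ A → L ⊆ A →
             Core D → W ⊆ Nbr D → L ⊆ Nbr W → (∀ u v → D u → L v → ¬ (u ~ v)) →
             ColourableOn L (2 + k)) where

    -- `Q` holds the vertices still to be coloured, and the last argument colours its part next to
    -- `D`. If that part is nonempty it joins the core; otherwise an edge left in `Q` seeds a new
    -- core.
    layerColouring : ∀ {D} Q → Acc _⊂_ Q → Decidable D → D ⊆ A → (∀ v → v ∈ Q → A v) → Core D →
                     ColourableOn (λ v → v ∈ Q × Nbr D v) (2 + k) → LayerColouring D Q (2 + k)
    layerColouring {D} Q (acc rec) D? D⊆A Q⊆A core (c , c-proper)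
      with any? (λ v → (v ∈? Q) ×-dec Nbr? D? v)
    ... | yes (w , Ww) = record
      { side = side′ ; colour = colour′ ; proper = proper′ ; firstSide = firstSide′ }
      where
      W : Pred Vertex 0ℓ
      W v = v ∈ Q × Nbr D v
      W? : Decidable W
      W? v = (v ∈? Q) ×-dec Nbr? D? v
      Rest? : Decidable (λ v → v ∈ Q × ¬ W v)
      Rest? v = (v ∈? Q) ×-dec ¬? (W? v)
      DW? : Decidable (D ∪ W)
      DW? v = D? v ⊎-dec W? v
      W⊆A : W ⊆ A
      W⊆A (v∈Q , _) = Q⊆A _ v∈Q
      L? : Decidable (λ v → v ∈ ⟪ Rest? ⟫ × Nbr (D ∪ W) v)
      L? v = (v ∈? ⟪ Rest? ⟫) ×-dec Nbr? DW? v
      far : ∀ {v} → v ∈ ⟪ Rest? ⟫ → ¬ Nbr D v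
      far v∈ nbr with v∈Q , ¬Wv ← ∈⟪⟫⁻ Rest? v∈ = ¬Wv (v∈Q , nbr)
      next : LayerColouring (D ∪ W) ⟪ Rest? ⟫ (2 + k)
      next = layerColouring ⟪ Rest? ⟫
        (rec ((λ v∈ → proj₁ (∈⟪⟫⁻ Rest? v∈)) , w , proj₁ Ww , λ w∈ → proj₂ (∈⟪⟫⁻ Rest? w∈) Ww))
        DW? [ D⊆A , W⊆A ]′ (λ v v∈ → Q⊆A v (proj₁ (∈⟪⟫⁻ Rest? v∈))) (core-extend core proj₂)
        (layer D? W? L? D⊆A W⊆A (λ (v∈ , _) → Q⊆A _ (proj₁ (∈⟪⟫⁻ Rest? v∈))) core proj₂
          -- A remaining vertex next to `D` would already be in `W`.
          (λ { (v∈ , u , inj₁ Du , u~v) → contradiction (u , Du , u~v) (far v∈)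
             ; (v∈ , u , inj₂ Wu , u~v) → u , Wu , u~v })
          (λ u v Du (v∈ , _) u~v → far v∈ (u , Du , u~v)))
      module N = LayerColouring next
      side′ : Vertex → Bool
      side′ v with W? v
      ... | yes _ = false
      -- The layer after `W` has side `false` in `next`; the flip sets it against `W`.
      ... | no _  = not (N.side v)
      colour′ : Vertex → Fin (2 + k)
      colour′ v with W? v
      ... | yes _ = c v
      ... | no _  = N.colour v
      crossing : ∀ {u v} → W u → v ∈ Q → ¬ W v → u ~ v → false ≢ not (N.side v)
      crossing Wu v∈Q ¬Wv u~v
        rewrite N.firstSide _ (∈⟪⟫⁺ Rest? (v∈Q , ¬Wv)) (_ , inj₂ Wu , u~v) = λ ()
      proper′ : ∀ u v → u ∈ Q → v ∈ Q → u ~ v → side′ u ≡ side′ v → colour′ u ≢ colour′ v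
      proper′ u v u∈Q v∈Q u~v eq with W? u | W? v
      ... | yes Wu | yes Wv = c-proper u v Wu Wv u~v
      ... | yes Wu | no ¬Wv = contradiction eq (crossing Wu v∈Q ¬Wv u~v)
      ... | no ¬Wu | yes Wv = contradiction (sym eq) (crossing Wv u∈Q ¬Wu (~-sym u~v))
      ... | no ¬Wu | no ¬Wv = N.proper u v (∈⟪⟫⁺ Rest? (u∈Q , ¬Wu)) (∈⟪⟫⁺ Rest? (v∈Q , ¬Wv))
                                u~v (not-injective eq)
      firstSide′ : ∀ v → v ∈ Q → Nbr D v → side′ v ≡ false
      firstSide′ v v∈Q nbr with W? v
      ... | yes _  = refl
      ... | no ¬Wv = contradiction (v∈Q , nbr) ¬Wv
    ... | no ¬W with any? (λ s → any? λ t → (s ∈? Q) ×-dec (t ∈? Q) ×-dec (s ~? t))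
    ...   | no edgeless = record
      { side = λ _ → false ; colour = λ _ → zero
      ; proper = λ u v u∈Q v∈Q u~v → contradiction (u , v , u∈Q , v∈Q , u~v) edgeless
      ; firstSide = λ _ _ _ → refl }
    ...   | yes (s , t , s∈Q , t∈Q , s~t) = record
      { side = side′ ; colour = colour′ ; proper = proper′
      ; firstSide = λ v v∈Q nbr → contradiction (v , v∈Q , nbr) ¬W }
      where
      E : Pred Vertex 0ℓ
      E v = v ≡ s ⊎ v ≡ t
      E? : Decidable E
      E? v = (v ≟ᶠ s) ⊎-dec (v ≟ᶠ t)
      Rest? : Decidable (λ v → v ∈ Q × ¬ E v)
      Rest? v = (v ∈? Q) ×-dec ¬? (E? v)
      next : LayerColouring E ⟪ Rest? ⟫ (2 + k)
      next = layerColouring ⟪ Rest? ⟫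
        (rec ((λ v∈ → proj₁ (∈⟪⟫⁻ Rest? v∈)) , s , s∈Q , λ s∈ → proj₂ (∈⟪⟫⁻ Rest? s∈) (inj₁ refl)))
        E? (λ { (inj₁ refl) → Q⊆A s s∈Q ; (inj₂ refl) → Q⊆A t t∈Q })
        (λ v v∈ → Q⊆A v (proj₁ (∈⟪⟫⁻ Rest? v∈))) (core-edge s~t)
        (colourable-⊆ (λ { (v∈ , _ , inj₁ refl , s~v) → Q⊆A _ (proj₁ (∈⟪⟫⁻ Rest? v∈)) , inj₁ s~v
                         ; (v∈ , _ , inj₂ refl , t~v) → Q⊆A _ (proj₁ (∈⟪⟫⁻ Rest? v∈)) , inj₂ t~v })
          (starts s t (Q⊆A s s∈Q) (Q⊆A t t∈Q)))
      module N = LayerColouring next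
      side′ : Vertex → Bool
      side′ v with E? v
      ... | yes _ = true
      -- No flip here: the seed takes `true`, opposite to the layer next to it.
      ... | no _  = N.side v
      colour′ : Vertex → Fin (2 + k)
      colour′ v with E? v
      -- The ends of the seed edge share a side, so they take two colours; hence palettes of size
      -- `2 + k`.
      ... | yes (inj₁ _) = zero
      ... | yes (inj₂ _) = suc zero
      ... | no _         = N.colour v
      crossing : ∀ {u v} → E u → v ∈ Q → ¬ E v → u ~ v → true ≢ N.side v
      crossing Eu v∈Q ¬Ev u~v
        rewrite N.firstSide _ (∈⟪⟫⁺ Rest? (v∈Q , ¬Ev)) (_ , Eu , u~v) = λ ()
      proper′ : ∀ u v → u ∈ Q → v ∈ Q → u ~ v → side′ u ≡ side′ v → colour′ u ≢ colour′ v
      proper′ u v u∈Q v∈Q u~v eq with E? u | E? v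
      ... | yes (inj₁ refl) | yes (inj₁ refl) = contradiction u~v (~-irr refl)
      ... | yes (inj₁ refl) | yes (inj₂ refl) = λ ()
      ... | yes (inj₂ refl) | yes (inj₁ refl) = λ ()
      ... | yes (inj₂ refl) | yes (inj₂ refl) = contradiction u~v (~-irr refl)
      ... | yes Eu | no ¬Ev = contradiction eq (crossing Eu v∈Q ¬Ev u~v)
      ... | no ¬Eu | yes Ev = contradiction (sym eq) (crossing Ev u∈Q ¬Eu (~-sym u~v))
      ... | no ¬Eu | no ¬Ev = N.proper u v (∈⟪⟫⁺ Rest? (u∈Q , ¬Eu)) (∈⟪⟫⁺ Rest? (v∈Q , ¬Ev)) u~v eq

    layered-colourable : Decidable A → ColourableOn A (2 * (2 + k))
    layered-colourable A? = (λ v → combine (code (side v)) (colour v)) ,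
      λ u v Au Av u~v eq →
        let sides , colours = combine-injective (code (side u)) _ (code (side v)) _ eq
        in proper u v (∈⟪⟫⁺ A? Au) (∈⟪⟫⁺ A? Av) u~v (code-injective sides) colours
      where
      layers : LayerColouring (λ _ → ⊥) ⟪ A? ⟫ (2 + k)
      -- The empty core has no neighbours, so the recursion begins by looking for a seed edge.
      layers = layerColouring ⟪ A? ⟫ (⊂-wellFounded _) (λ _ → no λ ())
        (λ ()) (λ _ → ∈⟪⟫⁻ A?) ((λ _ _ ()) , λ ())
        (colourable-edgeless λ { _ _ (_ , _ , () , _) })
      open LayerColouring layers
      code : Bool → Fin 2
      code false = zero
      code true  = suc zero
      code-injective : ∀ {x y} → code x ≡ code y → x ≡ y
      code-injective {false} {false} _ = refl
      code-injective {true}  {true}  _ = refl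

-- Colour bounds, and decompositions relative to a set of nodes.

colourBound : ℕ → ℕ → ℕ
layerBound  : ℕ → ℕ → ℕ
colourBound zero    m       = 1
colourBound (suc w) zero    = 1
colourBound (suc w) (suc m) = 2 * (2 + layerBound w m)
layerBound w m =
  -- One palette serves every layer. The first layer around a seed lies in two neighbourhoods,
  -- giving `c + c`; in later layers the next summand colours the vertices sharing a bag with the
  -- core, and the last one the others.
  (c + c) + (colourBound (suc w) m + suc (dominatedColours c (suc m) (suc w) (suc w)))
  where c = colourBound w (suc m)

module _ {G : Graph} (𝒯 : TreeDecomposition G) where
  open Graph G using (Vertex; _~_; _~?_; ~-sym)
  open TreeDecomposition 𝒯 using (tree; isTree; bag; coversVertices; coversEdges; connected)
  open Graph tree using () renaming (Vertex to Node; _~_ to _≈_)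

  -- The induction shrinks `A` and `N` while graph, tree and bags stay fixed.
  record DecomposesOn (A : Pred Vertex 0ℓ) (N : Pred Node 0ℓ) : Set where
    field
      vertices : ∀ v → A v → ∃[ x ] (N x × v ∈ bag x)
      edges    : ∀ u v → A u → A v → u ~ v → ∃[ x ] (N x × u ∈ bag x × v ∈ bag x)
      subtrees : ∀ v → A v → ConnectedOn tree (λ x → N x × v ∈ bag x)

  Meets : Pred Node 0ℓ → Pred Vertex 0ℓ
  Meets M v = ∃[ x ] (M x × v ∈ bag x)

  decomposes-⊆ : ∀ {A L N} → L ⊆ A → DecomposesOn A N → DecomposesOn L N
  decomposes-⊆ L⊆A dec = record
    { vertices = λ v Lv → vertices v (L⊆A Lv)
    ; edges    = λ u v Lu Lv → edges u v (L⊆A Lu) (L⊆A Lv)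
    ; subtrees = λ v Lv → subtrees v (L⊆A Lv) }
    where open DecomposesOn dec

  module _ {A : Pred Vertex 0ℓ} {N M : Pred Node 0ℓ} (dec : DecomposesOn A N)
           (M? : Decidable M) (M⊆N : M ⊆ N) (conn : ConnectedOn tree M) where
    open DecomposesOn dec

    -- The nodes of `N` whose bags hold `v` connect `x` to `M`; the first one in `M` on the way is
    -- the gate.
    gate-in-bag : ∀ {v x} → A v → N x → v ∈ bag x → Meets M v →
                  ∃[ z ] (Gate tree isTree M? x z × v ∈ bag z)
    gate-in-bag {v} Av Nx v∈x (y , My , v∈y) =
      map₂ (map₂ proj₂) (first-hit tree isTree M? (Nx , v∈x) My
                          (subtrees v Av _ _ (Nx , v∈x) (M⊆N My , v∈y)))

    -- Edges survive by the Helly property: a common bag of u and v has its gate to M in the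
    -- subtrees of both.
    restrict : ∀ {L} → L ⊆ A → L ⊆ Meets M → DecomposesOn L M
    restrict L⊆A meets = record
      { vertices = λ v Lv → meets Lv
      ; edges = λ u v Lu Lv u~v →
          let x , Nx , u∈x , v∈x = edges u v (L⊆A Lu) (L⊆A Lv) u~v
              z , g  , u∈z = gate-in-bag (L⊆A Lu) Nx u∈x (meets Lu)
              y , g′ , v∈y = gate-in-bag (L⊆A Lv) Nx v∈x (meets Lv)
          in z , proj₂ g , u∈z , subst (λ t → v ∈ bag t) (gate-unique tree isTree M? conn g′ g) v∈y
      ; subtrees = λ v Lv x y (Mx , v∈x) (My , v∈y) →
          mapStar (λ ((Ma , _ , v∈a) , (Mb , _ , v∈b) , a≈b) → (Ma , v∈a) , (Mb , v∈b) , a≈b)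
            (∩-connected tree isTree M? conn (subtrees v (L⊆A Lv)) x y
              (Mx , M⊆N Mx , v∈x) (My , M⊆N My , v∈y)) }

    -- No bag of `M` holds `v`, so the walk cannot enter `M`, and each step hands the gate on.
    gate-along : ∀ {v x y z} → ¬ Meets M v →
                 Star (λ a b → (N a × v ∈ bag a) × (N b × v ∈ bag b) × a ≈ b) x y →
                 Gate tree isTree M? x z → Gate tree isTree M? y z
    gate-along ¬meets ε g = g
    gate-along ¬meets ((_ , (_ , v∈b) , a≈b) ◅ w) g =
      gate-along ¬meets w (gate-back tree isTree M? (λ Mb → ¬meets (_ , Mb , v∈b)) a≈b g)

    GateOf : Vertex → Node → Set
    GateOf v z = ∃[ x ] (N x × v ∈ bag x × Gate tree isTree M? x z)

    gateOf-unique : ∀ {v x z y} → A v → ¬ Meets M v → N x → v ∈ bag x → Gate tree isTree M? x z →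
                    GateOf v y → z ≡ y
    gateOf-unique {v} Av ¬meets Nx v∈x g (t , Nt , v∈t , h) =
      gate-unique tree isTree M? conn
        (gate-along ¬meets (subtrees v Av _ _ (Nx , v∈x) (Nt , v∈t)) g) h

    -- The ends share a bag, and the gate of that bag is the gate of both.
    gateOf-edge : ∀ {u v y z} → A u → A v → ¬ Meets M u → ¬ Meets M v → u ~ v →
                  GateOf u y → GateOf v z → y ≡ z
    gateOf-edge {u} Au Av ¬mu ¬mv u~v (t , Nt , u∈t , g) h
      with x , Nx , u∈x , v∈x ← edges _ _ Au Av u~v =
      gateOf-unique Av ¬mv Nx v∈x
        (gate-along ¬mu (subtrees u Au _ _ (Nt , u∈t) (Nx , u∈x)) g) h

    -- By `gateOf-edge` no edge of `L` joins vertices with different gates, so every gate may reuse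
    -- the same palette.
    separated-colourable : ∀ {W L k} → Decidable W → Decidable L → W ⊆ A → L ⊆ A → W ⊆ Meets M →
      L ⊆ Nbr G W → (∀ v → L v → ¬ Meets M v) →
      (∀ y → M y → ColourableOn G (λ v → A v × Nbr G (λ w → W w × w ∈ bag y) v) k) →
      ColourableOn G L (suc k)
    separated-colourable {W} {L} {k} W? L? W⊆A L⊆A W⊆meets L⊆ ¬meets cols =
      (λ v → proj₁ (cols′ (gate v)) v) , proper
      where
      gates : ∀ v → L v → ∃[ z ] (GateOf v z × M z × Nbr G (λ w → W w × w ∈ bag z) v)
      gates v Lv with w , Ww , w~v ← L⊆ Lv
        with x , Nx , w∈x , v∈x ← edges w v (W⊆A Ww) (L⊆A Lv) w~v
        -- `w` shares the bag of `x` with `v` and occurs in a bag of `M`, so it lies in the bag of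
        -- the gate: `W` within that bag dominates `v`.
        with z , g , w∈z ← gate-in-bag (W⊆A Ww) Nx w∈x (W⊆meets Ww) =
        z , (x , Nx , v∈x , g) , proj₂ g , w , (Ww , w∈z) , w~v
      chosen = choose L? (proj₁ ∘ coversVertices) gates
      gate   = proj₁ chosen
      isGate = proj₂ chosen
      cols′ : ∀ y → ColourableOn G (λ v → M y × A v × Nbr G (λ w → W w × w ∈ bag y) v) (suc k)
      cols′ y with M? y
      ... | yes My = colourable-≤ G (n≤1+n k) (colourable-⊆ G proj₂ (cols y My))
      -- Off `M` the set is empty; `suc k` guarantees a colour for it.
      ... | no ¬My = colourable-edgeless G λ _ _ (My , _) → contradiction My ¬My
      proper : ∀ u v → L u → L v → u ~ v → proj₁ (cols′ (gate u)) u ≢ proj₁ (cols′ (gate v)) v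
      proper u v Lu Lv u~v with gu , Mu , nu ← isGate u Lu | gv , Mv , nv ← isGate v Lv
        rewrite gateOf-edge (L⊆A Lu) (L⊆A Lv) (¬meets u Lu) (¬meets v Lv) u~v gu gv =
        proj₂ (cols′ (gate v)) u v (Mv , L⊆A Lu , nu) (Mv , L⊆A Lv , nv) u~v

  -- The induction on the clique and matching bounds.

  module _ {A D : Pred Vertex 0ℓ} {N : Pred Node 0ℓ} (dec : DecomposesOn A N)
           (D⊆A : D ⊆ A) (D-conn : ConnectedOn G D) where
    open DecomposesOn dec

    -- A walk in `D` lifts to the tree: consecutive vertices share a bag, and the nodes of each
    -- vertex are connected.
    trace-connected : ConnectedOn tree (λ x → N x × ∃[ d ] (D d × d ∈ bag x))
    trace-connected x y (Nx , d , Dd , d∈x) (Ny , e , De , e∈y) = go Dd Nx d∈x (D-conn d e Dd De)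
      where
      Trace = λ x → N x × ∃[ d ] (D d × d ∈ bag x)
      Step  = λ a b → Trace a × Trace b × a ≈ b
      within : ∀ {d a b} → D d → N a → d ∈ bag a → N b → d ∈ bag b → Star Step a b
      within {d} Dd Na d∈a Nb d∈b =
        mapStar
          (λ ((Na , d∈a) , (Nb , d∈b) , a≈b) → (Na , d , Dd , d∈a) , (Nb , d , Dd , d∈b) , a≈b)
          (subtrees d (D⊆A Dd) _ _ (Na , d∈a) (Nb , d∈b))
      go : ∀ {d x} → D d → N x → d ∈ bag x → Star (λ u v → D u × D v × u ~ v) d e → Star Step x y
      go Dd Nx d∈x ε = within Dd Nx d∈x Ny e∈y
      go Dd Nx d∈x ((_ , Df , d~f) ◅ w) with t , Nt , d∈t , f∈t ← edges _ _ (D⊆A Dd) (D⊆A Df) d~f =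
        within Dd Nx d∈x Nt d∈t ◅◅ go Df Nt f∈t w

  bounded-colourable : ∀ w m {A N} → Decidable A → Decidable N → DecomposesOn A N →
    CliqueBound G w A → (∀ x → N x → MatchingBound G m (_∈ bag x) A) →
    ColourableOn G A (colourBound w m)
  bounded-colourable zero m A? N? dec cb mb =
    colourable-edgeless G λ u _ Au → contradiction Au (cb u)
  -- An edge inside `A` lies in a bag of `N` and would be a matching touching it.
  bounded-colourable (suc w) zero A? N? dec cb mb = colourable-edgeless G λ u v Au Av u~v →
    let x , Nx , u∈x , _ = DecomposesOn.edges dec u v Au Av u~v in mb x Nx u v Au Av u∈x u~v
  bounded-colourable (suc w) (suc m) {A} {N} A? N? dec cb mb = layered-colourable G starts layer A?
    where
    open DecomposesOn dec
    c = colourBound w (suc m)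
    nbhd : ∀ v → A v → ColourableOn G (λ u → A u × v ~ u) c
    nbhd v Av = bounded-colourable w (suc m) (λ u → A? u ×-dec (v ~? u)) N?
      (decomposes-⊆ proj₁ dec) (cb v Av) (λ x Nx → matchingBound-⊆ G (suc m) proj₁ (mb x Nx))
    starts : ∀ s t → A s → A t → ColourableOn G (λ v → A v × (s ~ v ⊎ t ~ v)) (2 + layerBound w m)
    starts s t As At = colourable-≤ G (≤-trans (m≤m+n _ _) (m≤n+m _ 2))
      (colourable-⊆ G (λ { (Av , inj₁ s~v) → inj₁ (Av , s~v) ; (Av , inj₂ t~v) → inj₂ (Av , t~v) })
        (colourable-∪ G (λ v → A? v ×-dec (s ~? v)) (nbhd s As) (nbhd t At)))
    layer : ∀ {D W L} → Decidable D → Decidable W → Decidable L → D ⊆ A → W ⊆ A → L ⊆ A →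
            Core G D → W ⊆ Nbr G D → L ⊆ Nbr G W → (∀ u v → D u → L v → ¬ (u ~ v)) →
            ColourableOn G L (2 + layerBound w m)
    layer {D} {W} {L} D? W? L? D⊆A W⊆A L⊆A (D-conn , D-nbr) W⊆ L⊆ far =
      colourable-≤ G (≤-trans (m≤n+m _ (c + c)) (m≤n+m _ 2))
        (colourable-⊆ G split (colourable-∪ G near? near-colourable
          (separated-colourable dec M? proj₁ M-conn W? (λ v → L? v ×-dec ¬? (meets? v)) W⊆A
            (L⊆A ∘ proj₁) W-meets (L⊆ ∘ proj₁) (λ _ → proj₂)
            -- The dominating vertices lie in `bag y`, so the matchings built from them touch
            -- `bag y`.
            λ y (Ny , _) → dominated-colourable G A? nbhd (suc w) (suc m)
              (λ v → W? v ×-dec (v ∈? bag y))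
              (λ v (Wv , v∈y) → W⊆A Wv , v∈y) cb (mb y Ny))))
      where
      M : Pred Node 0ℓ
      M x = N x × ∃[ d ] (D d × d ∈ bag x)
      M? : Decidable M
      M? x = N? x ×-dec any? λ d → D? d ×-dec (d ∈? bag x)
      M-conn : ConnectedOn tree M
      M-conn = trace-connected dec D⊆A D-conn
      meets? : Decidable (Meets M)
      meets? v = any? λ x → M? x ×-dec (v ∈? bag x)
      near? : Decidable (λ v → L v × Meets M v)
      near? v = L? v ×-dec meets? v
      W-meets : W ⊆ Meets M
      W-meets Wv with d , Dd , d~v ← W⊆ Wv
        with x , Nx , d∈x , v∈x ← edges d _ (D⊆A Dd) (W⊆A Wv) d~v = x , (Nx , d , Dd , d∈x) , v∈x
      near-bound : ∀ x → M x → MatchingBound G m (_∈ bag x) (λ v → L v × Meets M v)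
      -- The edge from `d` to `e` touches `bag x` and is anticomplete to `L`, so peeling it off
      -- keeps all of `L`.
      near-bound x (Nx , d , Dd , d∈x) with e , De , e~d ← D-nbr Dd =
        matchingBound-⊆ G m (λ (Lv , _) → L⊆A Lv , far d _ Dd Lv , far e _ De Lv)
          (mb x Nx d e (D⊆A Dd) (D⊆A De) d∈x (~-sym e~d))
      near-colourable : ColourableOn G (λ v → L v × Meets M v) (colourBound (suc w) m)
      near-colourable = bounded-colourable (suc w) m near? M?
        (restrict dec M? proj₁ M-conn (L⊆A ∘ proj₁) proj₂)
        (cliqueBound-⊆ G (suc w) (L⊆A ∘ proj₁) cb) near-bound
      split : ∀ {v} → L v → (L v × Meets M v) ⊎ (L v × ¬ Meets M v)
      split {v} Lv with meets? v
      ... | yes meets = inj₁ (Lv , meets)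
      ... | no ¬meets = inj₂ (Lv , ¬meets)

-- From clique number and touching matchings to the inductive bounds.

∣insert∣ : ∀ (S : Subset n) v → v ∉ S → ∣ S [ v ]≔ inside ∣ ≡ suc ∣ S ∣
∣insert∣ (inside  ∷ S) zero    v∉S = contradiction here v∉S
∣insert∣ (outside ∷ S) zero    v∉S = refl
∣insert∣ (inside  ∷ S) (suc v) v∉S = cong suc (∣insert∣ S v (v∉S ∘ there))
∣insert∣ (outside ∷ S) (suc v) v∉S = ∣insert∣ S v (v∉S ∘ there)

∈-insert⁻ : ∀ (S : Subset n) v {u} → u ∈ S [ v ]≔ inside → u ≡ v ⊎ u ∈ S
∈-insert⁻ S v {u} u∈ with u ≟ᶠ v
... | yes u≡v = inj₁ u≡v
... | no  u≢v = inj₂ (lookup⇒[]= u S (trans (sym (lookup∘update′ u≢v S inside)) ([]=⇒lookup u∈)))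

module _ (G : Graph) where
  open Graph G using (Vertex; _~_; ~-sym; ~-irr)

  -- `S` is the clique collected so far. Each descent moves a vertex of `P` into `S`, and at `k`
  -- zero one more vertex would exceed the bound.
  cliques⇒cliqueBound : ∀ k {j} {P : Pred Vertex 0ℓ} S → IsClique G S → ∣ S ∣ ≡ j →
    (∀ s v → s ∈ S → P v → s ~ v) → (∀ i → HasClique G i → i ≤ j + k) → CliqueBound G k P
  cliques⇒cliqueBound k {j} {P} S clique refl joined bound = go k bound
    where
    module _ {v} (Pv : P v) where
      S′ = S [ v ]≔ inside
      clique′ : IsClique G S′
      clique′ x y x∈ y∈ x≢y with ∈-insert⁻ S v x∈ | ∈-insert⁻ S v y∈
      ... | inj₁ refl | inj₁ refl = contradiction refl x≢y
      ... | inj₁ refl | inj₂ y∈S  = ~-sym (joined y v y∈S Pv)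
      ... | inj₂ x∈S  | inj₁ refl = joined x v x∈S Pv
      ... | inj₂ x∈S  | inj₂ y∈S  = clique x y x∈S y∈S x≢y
      size′ : ∣ S′ ∣ ≡ suc ∣ S ∣
      size′ = ∣insert∣ S v λ v∈S → ~-irr refl (joined v v v∈S Pv)
      joined′ : ∀ s u → s ∈ S′ → P u × v ~ u → s ~ u
      joined′ s u s∈ (Pu , v~u) with ∈-insert⁻ S v s∈
      ... | inj₁ refl = v~u
      ... | inj₂ s∈S  = joined s u s∈S Pu
    go : ∀ k → (∀ i → HasClique G i → i ≤ j + k) → CliqueBound G k P
    go zero bound v Pv = 1+n≰n
      (subst (suc j ≤_) (+-identityʳ j) (bound (suc j) (S′ Pv , clique′ Pv , size′ Pv)))
    go (suc k) bound v Pv = cliques⇒cliqueBound k (S′ Pv) (clique′ Pv) (size′ Pv) (joined′ Pv)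
      λ i h → subst (i ≤_) (+-suc j k) (bound i h)

  -- `e` collects the edges peeled off so far. As `P` avoids all neighbours of their ends, an edge
  -- inside `P` with an end in `X` extends `e`.
  matchings⇒matchingBound : ∀ m {j} {P : Pred Vertex 0ℓ} X (e : Edges G j) → IsInducedMatching G e →
    Touches G e X → (∀ i s v → P v → ¬ (e i s ~ v)) →
    (∀ i → HasTouchingMatching G X i → i ≤ j + m) → MatchingBound G m (_∈ X) P
  matchings⇒matchingBound m {j} {P} X e (edge , induced) touches far = go m
    where
    module _ {u v} (Pu : P u) (Pv : P v) (u∈X : u ∈ X) (u~v : u ~ v) where
      e′ : Edges G (suc j)
      e′ zero    zero       = u
      e′ zero    (suc zero) = v
      e′ (suc i) s          = e i s
      P-e′ : ∀ s → P (e′ zero s)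
      P-e′ zero       = Pu
      P-e′ (suc zero) = Pv
      apart : ∀ {w} → P w → ∀ i t → w ≢ e i t × ¬ (w ~ e i t)
      apart {w} Pw i t = distinct t , far i t w Pw ∘ ~-sym
        where
        distinct : ∀ t → w ≢ e i t
        -- An end of `e i` is adjacent to the other end, so it cannot lie in `P`.
        distinct zero       refl = far i (suc zero) w Pw (~-sym (edge i))
        distinct (suc zero) refl = far i zero w Pw (edge i)
      matching′ : IsInducedMatching G e′
      matching′ = (λ { zero → u~v ; (suc i) → edge i }) , λ
        { zero    zero    i≢j s t → contradiction refl i≢j
        ; zero    (suc j) i≢j s t → apart (P-e′ s) j t
        ; (suc i) zero    i≢j s t → let a , b = apart (P-e′ t) i s in a ∘ sym , b ∘ ~-sym
        ; (suc i) (suc j) i≢j s t → induced i j (i≢j ∘ cong suc) s t }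
      touches′ : Touches G e′ X
      touches′ zero    = zero , u∈X
      touches′ (suc i) = touches i
      far′ : ∀ i s w → P w × ¬ (u ~ w) × ¬ (v ~ w) → ¬ (e′ i s ~ w)
      far′ zero    zero       w (_ , u≁w , _) = u≁w
      far′ zero    (suc zero) w (_ , _ , v≁w) = v≁w
      far′ (suc i) s          w (Pw , _)      = far i s w Pw
    go : ∀ m → (∀ i → HasTouchingMatching G X i → i ≤ j + m) → MatchingBound G m (_∈ X) P
    go zero bound u v Pu Pv u∈X u~v = 1+n≰n (subst (suc j ≤_) (+-identityʳ j)
      (bound (suc j) (e′ Pu Pv u∈X u~v , matching′ Pu Pv u∈X u~v , touches′ Pu Pv u∈X u~v)))
    go (suc m) bound u v Pu Pv u∈X u~v = matchings⇒matchingBound m X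
      (e′ Pu Pv u∈X u~v) (matching′ Pu Pv u∈X u~v) (touches′ Pu Pv u∈X u~v) (far′ Pu Pv u∈X u~v)
      λ i h → subst (i ≤_) (+-suc j m) (bound i h)

  χ≤colourBound : ∀ (𝒯 : TreeDecomposition G) {b} → μ 𝒯 ≤ b → χ G ≤ colourBound (ω G) b
  χ≤colourBound 𝒯 {b} μ≤b = proj₂ (proj₂ (chromaticNumber G)) _
    (map₂ (λ proper u v → proper u v tt tt)
      (bounded-colourable 𝒯 (ω G) b {A = U} {N = U} (λ _ → yes tt) (λ _ → yes tt) decomposes
        (cliques⇒cliqueBound (ω G) ∅ (λ _ _ u∈∅ → contradiction u∈∅ ∉⊥) (∣⊥∣≡0 (Graph.order G))
          (λ _ _ s∈∅ → contradiction s∈∅ ∉⊥) (proj₂ (proj₂ (cliqueNumber G))))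
        λ x _ → matchings⇒matchingBound b (bag x) (λ ()) ((λ ()) , λ ()) (λ ()) (λ ())
          (touching x)))
    where
    open TreeDecomposition 𝒯
    decomposes : DecomposesOn 𝒯 U U
    decomposes = record
      { vertices = λ v _ → map₂ (tt ,_) (coversVertices v)
      ; edges    = λ u v _ _ u~v → map₂ (tt ,_) (coversEdges u v u~v)
      ; subtrees = λ v _ x y (_ , v∈x) (_ , v∈y) →
          mapStar (λ (v∈a , v∈b , a~b) → (tt , v∈a) , (tt , v∈b) , a~b) (connected v x y v∈x v∈y) }
    touching : ∀ x i → HasTouchingMatching G (bag x) i → i ≤ b
    touching x i h = ≤-trans (proj₂ (proj₂ (touchingNumber G (bag x))) i h) (≤-trans
      (lookup (xs≤max 0 (map (maxTouching G ∘ bag) (allFin _)))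
              (∈-map⁺ (maxTouching G ∘ bag) (∈-allFin x)))
      μ≤b)

theorem1p3 : ∀ {ℓ} (𝒢 : GraphClass ℓ) → BoundedTree-μ 𝒢 → χ-Bounded 𝒢
theorem1p3 𝒢 (b , bounded) = (λ w → colourBound w b) , λ G G∈𝒢 →
  let m , ((𝒯 , μ≡m) , _) , m≤b = bounded G G∈𝒢
  in χ≤colourBound G 𝒯 (subst (_≤ b) (sym μ≡m) m≤b)
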